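{- Let $G$ be a $(P_5,\textit{HVN})$-free graph that contains an induced $Y$-5-wheel and contains no induced $T$-5-wheel. Then $G$ is $(\omega(G)+3)$-colorable.
   Context: Graphs are finite, simple and connected. $P_5$ is the path on 5 vertices; an HVN is a $K_4$ plus a vertex adjacent to exactly two vertices of the $K_4$; $(H_1,H_2)$-free means no induced $H_1$ or $H_2$. A $T$-5-wheel is a chordless 5-cycle $v_1v_2v_3v_4v_5v_1$ plus a vertex adjacent to exactly three consecutive vertices of it (e.g. $v_5,v_1,v_2$). A $Y$-5-wheel is a chordless 5-cycle $v_1v_2v_3v_4v_5v_1$ plus a vertex adjacent to exactly $v_1,v_2,v_4$. $\omega(G)$ is the clique number. -}

module Defs where

open import Data.Nat using (ℕ; suc; _+_)
open import Data.Fin using (Fin; zero; suc; _≟_)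
open import Data.Bool using (Bool; true; false; _∧_; _∨_; not)
open import Data.Bool.Properties using (∨-comm)
open import Data.Product using (Σ; _×_; _,_)
open import Data.List using (List; []; _∷_)
open import Data.Bool.ListAction using (any)
open import Relation.Binary.PropositionalEquality using (_≡_; refl; sym; cong₂)
open import Relation.Nullary using (¬_; does; yes; no)
open import Function.Definitions using (Injective)

record Graph (n : ℕ) : Set where
  field
    adj    : Fin n → Fin n → Bool
    adj-sym    : ∀ u v → adj u v ≡ adj v u
    adj-irrefl : ∀ v → adj v v ≡ false
open Graph public

Adj : ∀ {n} → Graph n → Fin n → Fin n → Set
Adj G u v = adj G u v ≡ true

data Walk {n : ℕ} (G : Graph n) : Fin n → Fin n → Set where
  here : ∀ v → Walk G v v
  step : ∀ u w v → Adj G u w → Walk G w v → Walk G u v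

Connected : ∀ {n} → Graph n → Set
Connected G = ∀ u v → Walk G u v

InducedSub : ∀ {m n} → Graph m → Graph n → Set
InducedSub {m} {n} H G =
  Σ (Fin m → Fin n) λ f →
    Injective _≡_ _≡_ f × (∀ u v → adj G (f u) (f v) ≡ adj H u v)

Contains : ∀ {m n} → Graph n → Graph m → Set
Contains G H = InducedSub H G

Free : ∀ {m n} → Graph m → Graph n → Set
Free H G = ¬ InducedSub H G

private
  eqF : ∀ {k} → Fin k → Fin k → Bool
  eqF u v = does (u ≟ v)

  eqF-sym : ∀ {k} (u v : Fin k) → eqF u v ≡ eqF v u
  eqF-sym u v with u ≟ v | v ≟ u
  ... | yes _ | yes _ = refl
  ... | no _  | no _  = refl
  ... | yes p | no q  = Data.Empty.⊥-elim (q (sym p))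
    where import Data.Empty
  ... | no p  | yes q = Data.Empty.⊥-elim (p (sym q))
    where import Data.Empty

  eqF-refl : ∀ {k} (v : Fin k) → eqF v v ≡ true
  eqF-refl v with v ≟ v
  ... | yes _ = refl
  ... | no p  = Data.Empty.⊥-elim (p refl)
    where import Data.Empty

  edge? : ∀ {k} → List (Fin k × Fin k) → Fin k → Fin k → Bool
  edge? es u v = any (λ { (a , b) → eqF a u ∧ eqF b v }) es

fromEdges : ∀ {k} → List (Fin k × Fin k) → Graph k
fromEdges {k} es = record
  { adj = A ; adj-sym = S ; adj-irrefl = I }
  where
  A : Fin k → Fin k → Bool
  A u v = not (eqF u v) ∧ (edge? es u v ∨ edge? es v u)
  S : ∀ u v → A u v ≡ A v u
  S u v = cong₂ _∧_ (cong₂ (λ x (_ : Bool) → not x) (eqF-sym u v) (refl {x = true}))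
                    (∨-comm (edge? es u v) (edge? es v u))
  I : ∀ v → A v v ≡ false
  I v rewrite eqF-refl v = refl

v0 v1 v2 v3 v4 v5 : Fin 6
v0 = zero
v1 = suc zero
v2 = suc (suc zero)
v3 = suc (suc (suc zero))
v4 = suc (suc (suc (suc zero)))
v5 = suc (suc (suc (suc (suc zero))))

P5 : Graph 5
P5 = fromEdges ((0' , 1') ∷ (1' , 2') ∷ (2' , 3') ∷ (3' , 4') ∷ [])
  where
  0' 1' 2' 3' 4' : Fin 5
  0' = zero
  1' = suc zero
  2' = suc (suc zero)
  3' = suc (suc (suc zero))
  4' = suc (suc (suc (suc zero)))

-- HVN: K4 on {0,1,2,3} plus vertex 4 adjacent to exactly 0 and 1
HVN : Graph 5
HVN = fromEdges ((0' , 1') ∷ (0' , 2') ∷ (0' , 3') ∷ (1' , 2') ∷ (1' , 3')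
                 ∷ (2' , 3') ∷ (4' , 0') ∷ (4' , 1') ∷ [])
  where
  0' 1' 2' 3' 4' : Fin 5
  0' = zero
  1' = suc zero
  2' = suc (suc zero)
  3' = suc (suc (suc zero))
  4' = suc (suc (suc (suc zero)))

C5edges : List (Fin 6 × Fin 6)
C5edges = (v1 , v2) ∷ (v2 , v3) ∷ (v3 , v4) ∷ (v4 , v5) ∷ (v5 , v1) ∷ []

T5Wheel : Graph 6
T5Wheel = fromEdges ((v0 , v5) ∷ (v0 , v1) ∷ (v0 , v2) ∷ C5edges)

Y5Wheel : Graph 6
Y5Wheel = fromEdges ((v0 , v1) ∷ (v0 , v2) ∷ (v0 , v4) ∷ C5edges)

IsClique : ∀ {n} → Graph n → List (Fin n) → Set
IsClique G vs =
  Data.List.Relation.Unary.Unique.Propositional.Unique vs ×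
  (∀ {u v} → u Data.List.Membership.Propositional.∈ vs →
             v Data.List.Membership.Propositional.∈ vs → u ≢ v → Adj G u v)
  where
  import Data.List.Relation.Unary.Unique.Propositional
  import Data.List.Membership.Propositional
  open import Relation.Binary.PropositionalEquality using (_≢_)

IsCliqueNumber : ∀ {n} → Graph n → ℕ → Set
IsCliqueNumber G ω =
  Σ (List _) (λ vs → IsClique G vs × Data.List.length vs ≡ ω) ×
  (∀ vs → IsClique G vs → Data.List.length vs Data.Nat.≤ ω)
  where import Data.List
        import Data.Nat

Colorable : ∀ {n} → Graph n → ℕ → Set
Colorable {n} G k = Σ (Fin n → Fin k) λ c → ∀ u v → Adj G u v → ¬ (c u ≡ c v)

{-# OPTIONS --safe #-}
-- Fix an induced Y-5-wheel: a rim C and a centre x.  By P5-freeness and the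
-- absence of T-5-wheels, a vertex with a neighbour on C (a "near" vertex) is
-- classified by the set of its neighbours in the wheel, and few sets occur.
-- Which sets occur, and which of them force an edge or a non-edge between two
-- vertices, are finite questions, settled by searching all patterns on at most
-- eleven vertices.  The outcome is a 6-colouring of the near vertices that
-- depends only on the neighbours in the wheel, enlarged by one more vertex z if
-- some z sees the centre and all of C except one end of the rim edge that lies
-- in a triangle with the centre.
--
-- The vertices without a neighbour on C (the "distant" ones) need more room.
-- If a near vertex is adjacent to a distant t, then it is adjacent to the whole
-- component of t among the distant vertices.  As G is connected, every such
-- component K is complete to some near vertex, so HVN-freeness makes K
-- paw-free.  A connected paw-free P5-free graph is complete multipartite or
-- triangle-free, and in the latter case 3-colourable; thus K is ω-colourable
-- (ω ≥ 3, since a wheel contains a triangle).  Finally, if K has an edge, its near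
-- neighbours use at most three of the six colours, so together with ω − 3 new
-- colours ω of them are left for K.
module Submission where

open import Data.Nat using (ℕ; zero; suc; _+_; _≤_; s≤s)
open import Data.Nat.Properties using (+-comm)
open import Data.Bool using (Bool; true; false; _∧_; if_then_else_)
open import Data.Bool.Properties using (¬-not; ∧-zeroʳ; ∧-comm) renaming (_≟_ to _≟ᵇ_)
open import Data.Empty using (⊥; ⊥-elim)
open import Data.Fin using (Fin; zero; suc; _↑ˡ_; inject≤; splitAt; join) renaming (_<_ to _<ᶠ_)
open import Data.Fin.Properties
  using (all?; any?; inject≤-injective; ↑ˡ-injective; splitAt-join; join-splitAt)
  renaming (_≟_ to _≟ᶠ_; <-cmp to <ᶠ-cmp; <-asym to <ᶠ-asym; _<?_ to _<ᶠ?_)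
import Data.List as List
open import Data.List using (List; []; _∷_; concatMap; null; filter; length; cartesianProductWith)
open import Data.List.Membership.Propositional using (_∈_; find)
open import Data.List.Membership.Propositional.Properties
  using (∈-concatMap⁻; ∈-map⁻; ∈-filter⁻; ∈-filter⁺; ∈-cartesianProductWith⁺; ∈-allFin; ∈-lookup)
open import Data.List.Relation.Unary.All as All using (All; []; _∷_)
open import Data.List.Relation.Unary.All.Properties using (¬Any⇒All¬)
open import Data.List.Relation.Unary.AllPairs using ([]; _∷_)
open import Data.List.Relation.Unary.Any as Any using (Any; here; there)
open import Data.List.Relation.Unary.Any.Properties using (lookup-index)
open import Data.Product using (Σ; ∃; _×_; _,_; proj₁; proj₂)
open import Data.Sum using (_⊎_; inj₁; inj₂; [_,_]; map₁)
open import Data.Sum.Properties using (inj₁-injective; inj₂-injective)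
import Data.Vec as Vec
open import Data.Vec using (Vec; []; _∷_; _++_; lookup; map; replicate; drop)
open import Data.Vec.Properties using (≡-dec; lookup-map; lookup-allFin; map-∘; map-cong)
open import Function using (_∘_; mk⇔)
open import Relation.Binary.Definitions using (tri<; tri≈; tri>)
open import Relation.Binary.PropositionalEquality
  using (_≡_; _≢_; refl; sym; trans; cong; cong₂; subst; subst₂)
open import Relation.Nullary using (¬_; Dec; yes; no; does)
open import Relation.Nullary.Decidable
  using (toWitness; from-yes; _→-dec_; _×-dec_; _⊎-dec_; ¬?; does-⇔; map′; decidable-stable; dec-true)
open import Defs

-- Adjacency matrices of vertex tuples and the search for induced copies

pattern I = true
pattern O = false

infixl 4 _▹_

-- The strict lower triangle of a symmetric matrix with zero diagonal; the
-- vertex added last has index zero.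
data Mat : ℕ → Set where
  []  : Mat 0
  _▹_ : ∀ {k} → Mat k → Vec Bool k → Mat (suc k)

entry : ∀ {k} → Mat k → Fin k → Fin k → Bool
entry (M ▹ r) zero    zero    = false
entry (M ▹ r) zero    (suc j) = lookup r j
entry (M ▹ r) (suc i) zero    = lookup r i
entry (M ▹ r) (suc i) (suc j) = entry M i j

matOf : ∀ {A : Set} {k} → (A → A → Bool) → Vec A k → Mat k
matOf E []       = []
matOf E (v ∷ vs) = matOf E vs ▹ map (E v) vs

entry-matOf : ∀ {n k} (G : Graph n) (vs : Vec (Fin n) k) i j →
  entry (matOf (adj G) vs) i j ≡ adj G (lookup vs i) (lookup vs j)
entry-matOf G (v ∷ vs) zero    zero    = sym (adj-irrefl G v)
entry-matOf G (v ∷ vs) zero    (suc j) = lookup-map j (adj G v) vs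
entry-matOf G (v ∷ vs) (suc i) zero    =
  trans (lookup-map i (adj G v) vs) (adj-sym G v (lookup vs i))
entry-matOf G (v ∷ vs) (suc i) (suc j) = entry-matOf G vs i j

matOf-map : ∀ {A B : Set} {k} {E : A → A → Bool} {F : B → B → Bool} (h : B → A) →
  (∀ i j → F i j ≡ E (h i) (h j)) → (vs : Vec B k) → matOf E (map h vs) ≡ matOf F vs
matOf-map h e []       = refl
matOf-map {E = E} h e (v ∷ vs) = cong₂ _▹_ (matOf-map h e vs)
  (trans (sym (map-∘ (E (h v)) h vs)) (map-cong (λ j → sym (e v j)) vs))

-- Backtracking search for the maps that preserve adjacency and non-adjacency; injectivity comes
-- later, from `TwinFree`.
copies : ∀ {m k} → Mat m → Mat k → List (Vec (Fin k) m)
copies []      M = [] ∷ []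
copies (H ▹ r) M = concatMap extend (copies H M)
  where
  extend : Vec (Fin _) _ → List (Vec (Fin _) _)
  extend g = List.map (_∷ g) (filter (λ i → ≡-dec _≟ᵇ_ (map (entry M i) g) r) (List.allFin _))

copies-sound : ∀ {m k} (H : Mat m) (M : Mat k) {g} → g ∈ copies H M → matOf (entry M) g ≡ H
copies-sound []      M {[]} _ = refl
copies-sound (H ▹ r) M {g}  p with find (∈-concatMap⁻ _ {xs = copies H M} p)
... | g′ , g′∈ , q with ∈-map⁻ (_∷ g′) q
... | i , i∈ , refl = cong₂ _▹_ (copies-sound H M g′∈)
  (proj₂ (∈-filter⁻ (λ i → ≡-dec _≟ᵇ_ (map (entry M i) g′) r) {xs = List.allFin _} i∈))

-- In a twin-free graph no two vertices have the same neighbours, so every map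
-- that preserves adjacency and non-adjacency is injective.
TwinFree : ∀ {m} → Graph m → Set
TwinFree H = ∀ i j → (∀ k → adj H i k ≡ adj H j k) → i ≡ j

twinFree? : ∀ {m} (H : Graph m) → Dec (TwinFree H)
twinFree? H = all? λ i → all? λ j → (all? λ k → adj H i k ≟ᵇ adj H j k) →-dec (i ≟ᶠ j)

matrix : ∀ {m} → Graph m → Mat m
matrix H = matOf (adj H) (Vec.allFin _)

entry-matrix : ∀ {m} (H : Graph m) i j → entry (matrix H) i j ≡ adj H i j
entry-matrix H i j = trans (entry-matOf H (Vec.allFin _) i j) (cong₂ (adj H) (lookup-allFin i) (lookup-allFin j))

matrix⇒induced : ∀ {n m} {G : Graph n} {H : Graph m} → TwinFree H → (vs : Vec (Fin n) m) →
  matOf (adj G) vs ≡ matrix H → InducedSub H G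
matrix⇒induced {G = G} {H} tw vs eq = lookup vs , inj , pres
  where
  pres : ∀ i j → adj G (lookup vs i) (lookup vs j) ≡ adj H i j
  pres i j = trans (sym (entry-matOf G vs i j)) (trans (cong (λ M → entry M i j) eq) (entry-matrix H i j))
  inj : ∀ {i j} → lookup vs i ≡ lookup vs j → i ≡ j
  inj {i} {j} e = tw i j λ k →
    trans (sym (pres i k)) (trans (cong (λ v → adj G v (lookup vs k)) e) (pres j k))

-- A copy found by the search, composed with `lookup vs`, is injective by twin-freeness even if `vs`
-- repeats vertices. Hence `admissible` holds of all tuples, and no later check has to separate
-- cases of coinciding vertices.
copy⇒induced : ∀ {n m k} {G : Graph n} {H : Graph m} → TwinFree H → ∀ {P} → P ≡ matrix H →
  (vs : Vec (Fin n) k) → Free H G → null (copies P (matOf (adj G) vs)) ≡ true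
copy⇒induced {G = G} {H} tw {P} P≡ vs free with copies P (matOf (adj G) vs) in eq
... | []    = refl
... | g ∷ _ = ⊥-elim (free (matrix⇒induced {G = G} {H} tw (map (lookup vs) g)
  (trans (matOf-map {E = adj G} (lookup vs) (entry-matOf G vs) g)
         (trans (copies-sound P _ (subst (g ∈_) (sym eq) (here refl))) P≡))))

-- The values of matrix on these graphs, written out so that the evaluation of
-- admissible does not recompute them.
P5ᵐ HVNᵐ : Mat 5
P5ᵐ = [] ▹ [] ▹ (I ∷ []) ▹ (I ∷ O ∷ []) ▹ (I ∷ O ∷ O ∷ []) ▹ (I ∷ O ∷ O ∷ O ∷ [])
HVNᵐ = [] ▹ [] ▹ (O ∷ []) ▹ (I ∷ O ∷ []) ▹ (I ∷ I ∷ I ∷ []) ▹ (I ∷ I ∷ I ∷ I ∷ [])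

T5ᵐ Y5ᵐ : Mat 6
T5ᵐ = [] ▹ [] ▹ (I ∷ []) ▹ (I ∷ O ∷ []) ▹ (I ∷ O ∷ O ∷ []) ▹ (I ∷ O ∷ O ∷ I ∷ [])
  ▹ (I ∷ I ∷ O ∷ O ∷ I ∷ [])
Y5ᵐ = [] ▹ [] ▹ (I ∷ []) ▹ (I ∷ O ∷ []) ▹ (I ∷ O ∷ O ∷ []) ▹ (I ∷ O ∷ O ∷ I ∷ [])
  ▹ (I ∷ I ∷ O ∷ I ∷ O ∷ [])

admissible : ∀ {k} → Mat k → Bool
admissible M = null (copies P5ᵐ M) ∧ null (copies HVNᵐ M) ∧ null (copies T5ᵐ M)

record Admissible {n : ℕ} (G : Graph n) : Set where
  constructor mkAdmissible
  field admissible-tuple : ∀ {k} (vs : Vec (Fin n) k) → admissible (matOf (adj G) vs) ≡ true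

free⇒admissible : ∀ {n} {G : Graph n} → Free P5 G → Free HVN G → Free T5Wheel G → Admissible G
free⇒admissible {n} {G} p5 hvn t5 = mkAdmissible tuple
  where
  tuple : ∀ {k} (vs : Vec (Fin n) k) → admissible (matOf (adj G) vs) ≡ true
  tuple vs
    rewrite copy⇒induced {G = G} {P5} (from-yes (twinFree? P5)) {P5ᵐ} refl vs p5
          | copy⇒induced {G = G} {HVN} (from-yes (twinFree? HVN)) {HVNᵐ} refl vs hvn
          | copy⇒induced {G = G} {T5Wheel} (from-yes (twinFree? T5Wheel)) {T5ᵐ} refl vs t5 = refl

-- A record and not an equation, so that M can be inferred.
record Blocked {k : ℕ} (M : Mat k) : Set where
  constructor blocked
  field inadmissible : admissible M ≡ false

blocked? : ∀ {k} {M : Mat k} → Dec (Blocked M)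
blocked? {M = M} = map′ blocked Blocked.inadmissible (admissible M ≟ᵇ false)

admissible⇒¬blocked : ∀ {n k} {G : Graph n} → Admissible G →
  (vs : Vec (Fin n) k) → ¬ Blocked (matOf (adj G) vs)
admissible⇒¬blocked adm vs (blocked b) with trans (sym b) (Admissible.admissible-tuple adm vs)
... | ()

-- Colouring paw-free graphs without an induced five-vertex path

firstIn : ∀ {n} → List (Fin n) → (Fin n → Bool) → Fin n → Fin n
firstIn []       p d = d
firstIn (x ∷ xs) p d = if p x then x else firstIn xs p d

firstIn-true : ∀ {n xs} {p : Fin n → Bool} {i d} → i ∈ xs → p i ≡ true → p (firstIn xs p d) ≡ true
firstIn-true {xs = x ∷ xs} {p} i∈ pi with p x in px
... | true = px
firstIn-true (here refl) pi | false with trans (sym px) pi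
... | ()
firstIn-true (there i∈) pi | false = firstIn-true i∈ pi

-- The choice depends on the predicate alone once there is a witness. This makes `root` constant on
-- components and lets `anchor` be compared between vertices.
firstIn-cong : ∀ {n xs} {p q : Fin n → Bool} {i d e} → (∀ j → p j ≡ q j) → i ∈ xs → p i ≡ true →
  firstIn xs p d ≡ firstIn xs q e
firstIn-cong {xs = x ∷ xs} {p} {q} p≗q i∈ pi with p x in px | q x in qx
... | true  | true  = refl
... | true  | false with trans (sym px) (trans (p≗q x) qx)
... | ()
firstIn-cong {xs = x ∷ xs} p≗q i∈ pi | false | true with trans (sym px) (trans (p≗q x) qx)
... | ()
firstIn-cong p≗q (here refl) pi | false | false with trans (sym px) pi
... | ()
firstIn-cong p≗q (there i∈) pi | false | false = firstIn-cong p≗q i∈ pi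

-- The edges and non-edges listed force the five vertices to be distinct.
PathFree : ∀ {n} → Graph n → Set
PathFree H = ∀ {a b c d e} → Adj H a b → Adj H b c → Adj H c d → Adj H d e →
  ¬ Adj H a c → ¬ Adj H a d → ¬ Adj H a e → ¬ Adj H b d → ¬ Adj H b e → ¬ Adj H c e → ⊥

PawFree : ∀ {n} → Graph n → Set
PawFree H = ∀ {a b c d} → Adj H a b → Adj H a c → Adj H b c → Adj H a d → Adj H b d ⊎ Adj H c d

adj? : ∀ {n} (H : Graph n) u v → Dec (Adj H u v)
adj? H u v = adj H u v ≟ᵇ true

does⇒ : ∀ {A : Set} (a? : Dec A) → does a? ≡ true → A
does⇒ (yes a) _ = a

module Components {n : ℕ} (H : Graph n) (path-free : PathFree H) where

  sw : ∀ {u v} → Adj H u v → Adj H v u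
  sw {u} {v} = trans (adj-sym H v u)

  ¬loop : ∀ {v} → ¬ Adj H v v
  ¬loop {v} vv with trans (sym vv) (adj-irrefl H v)
  ... | ()

  -- By `reach-step`, distance at most 3 already describes the components, and a bounded distance is
  -- decidable by search.
  Reach : ℕ → Fin n → Fin n → Set
  Reach zero    r v = r ≡ v
  Reach (suc k) r v = Reach k r v ⊎ ∃ λ w → Reach k r w × Adj H w v

  reach? : ∀ k r v → Dec (Reach k r v)
  reach? zero    r v = r ≟ᶠ v
  reach? (suc k) r v = reach? k r v ⊎-dec any? λ w → reach? k r w ×-dec adj? H w v

  reach-refl : ∀ {k v} → Reach k v v
  reach-refl {zero}  = refl
  reach-refl {suc k} = inj₁ reach-refl

  -- A shortest path with four edges would be an induced P5.
  reach-step : ∀ {r v w} → Reach 3 r v → Adj H v w → Reach 3 r w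
  reach-step {r} {v} {w} rv vw = decidable-stable (reach? 3 r w) λ ¬rw → far rv ¬rw
    where
    far : Reach 3 r v → ¬ ¬ Reach 3 r w
    far (inj₁ r2v) ¬w = ¬w (inj₂ (v , r2v , vw))
    far (inj₂ (b , inj₁ r1b , bv)) ¬w = ¬w (inj₂ (v , inj₂ (b , r1b , bv) , vw))
    far (inj₂ (b , inj₂ (c , inj₁ r0c , cb) , bv)) ¬w =
      ¬w (inj₂ (v , inj₂ (b , inj₂ (c , r0c , cb) , bv) , vw))
    far (inj₂ (b , inj₂ (c , inj₂ (_ , refl , rc) , cb) , bv)) ¬w = path-free rc cb bv vw
      (λ rb → ¬w (inj₂ (v , inj₂ (b , inj₂ (r , refl , rb) , bv) , vw)))
      (λ rv′ → ¬w (inj₂ (v , inj₁ (inj₂ (r , refl , rv′)) , vw)))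
      (λ rw → ¬w (inj₁ (inj₁ (inj₂ (r , refl , rw)))))
      (λ cv → ¬w (inj₂ (v , inj₂ (c , inj₂ (r , refl , rc) , cv) , vw)))
      (λ cw → ¬w (inj₁ (inj₂ (c , inj₂ (r , refl , rc) , cw))))
      (λ bw → ¬w (inj₂ (b , inj₂ (c , inj₂ (r , refl , rc) , cb) , bw)))

  module _ {P : Fin n → Set} (closed : ∀ {u v} → Adj H u v → P u → P v) where

    along : ∀ k {r v} → Reach k r v → P r → P v
    along zero    refl             p = p
    along (suc k) (inj₁ rv)        p = along k rv p
    along (suc k) (inj₂ (w , rw , wv)) p = closed wv (along k rw p)

    back : ∀ k {r v} → Reach k r v → P v → P r
    back zero    refl             p = p
    back (suc k) (inj₁ rv)        p = back k rv p
    back (suc k) (inj₂ (w , rw , wv)) p = back k rw (closed (sw wv) p)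

  root : Fin n → Fin n
  root v = firstIn (List.allFin n) (λ r → does (reach? 3 r v)) v

  root-reaches : ∀ v → Reach 3 (root v) v
  root-reaches v = does⇒ (reach? 3 (root v) v)
    (firstIn-true {p = λ r → does (reach? 3 r v)} (∈-allFin v) (dec-true (reach? 3 v v) (reach-refl {3})))

  root-cong : ∀ {u v} → Adj H u v → root u ≡ root v
  root-cong {u} {v} uv = firstIn-cong
    (λ r → does-⇔ (mk⇔ (λ ru → reach-step ru uv) (λ rv → reach-step rv (sw uv)))
             (reach? 3 r u) (reach? 3 r v))
    (∈-allFin u) (dec-true (reach? 3 u u) (reach-refl {3}))

  ComponentColorable : ℕ → Fin n → Set
  ComponentColorable k r = Σ (Fin n → Fin k) λ c →
    ∀ {u v} → Reach 3 r u → Reach 3 r v → Adj H u v → c u ≢ c v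

  componentwise : ∀ {k} → (∀ r → ComponentColorable k r) → Colorable H k
  componentwise col = (λ v → proj₁ (col (root v)) v) , λ u v uv →
    subst (λ r → proj₁ (col (root u)) u ≢ proj₁ (col r) v) (root-cong uv)
      (proj₂ (col (root u)) (root-reaches u) (subst (λ r → Reach 3 r v) (sym (root-cong uv)) (root-reaches v)) uv)

  -- The first and the third distance class of r are independent and share a
  -- colour.  In the second class, neighbours of a common vertex of that class
  -- have the same neighbours in the first class (transfer) whereas adjacent
  -- vertices have disjoint ones, so comparing a representative of them (anchor)
  -- with that of a neighbour splits each component of the class into two
  -- independent sets.
  module Levels (r : Fin n)
    (triangle-free : ∀ {a b c} → Reach 3 r a → Adj H a b → Adj H a c → ¬ Adj H b c) where

    Second : Fin n → Set
    Second v = ¬ Adj H r v × ∃ λ w → Adj H r w × Adj H w v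

    second? : ∀ v → Dec (Second v)
    second? v = ¬? (adj? H r v) ×-dec any? λ w → adj? H r w ×-dec adj? H w v

    anchors : Fin n → Fin n → Bool
    anchors b w = does (adj? H r w ×-dec adj? H w b)

    anchor : Fin n → Fin n
    anchor b = firstIn (List.allFin n) (anchors b) r

    anchor-adj : ∀ {b} → Second b → Adj H r (anchor b) × Adj H (anchor b) b
    anchor-adj {b} (_ , w , rw , wb) = does⇒ (adj? H r (anchor b) ×-dec adj? H (anchor b) b)
      (firstIn-true {p = anchors b} (∈-allFin w) (dec-true (adj? H r w ×-dec adj? H w b) (rw , wb)))

    -- Otherwise `r`, `w`, `b′`, `b`, `b″` would be an induced P5: `r` misses the second class, and
    -- the remaining chords would close triangles.
    transfer : ∀ {b b′ b″ w} → Reach 3 r b → Second b → Second b′ → Second b″ →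
      Adj H b b′ → Adj H b b″ → Adj H r w → Adj H w b′ → Adj H w b″
    transfer {b″ = b″} {w} rb (¬rb , _) (¬rb′ , _) (¬rb″ , _) bb′ bb″ rw wb′ =
      decidable-stable (adj? H w b″) λ ¬wb″ → path-free rw wb′ (sw bb′) bb″ ¬rb′ ¬rb ¬rb″
        (λ wb → triangle-free rb (sw wb) bb′ wb′) ¬wb″ (triangle-free rb bb′ bb″)

    anchor-unique : ∀ {b b′ b″} → Reach 3 r b → Second b → Second b′ → Second b″ →
      Adj H b b′ → Adj H b b″ → anchor b′ ≡ anchor b″
    anchor-unique {b} {b′} {b″} rb s s′@(_ , w , rw , wb′) s″ bb′ bb″ = firstIn-cong
      (λ w → does-⇔ (mk⇔ (λ (rw , wb′) → rw , transfer rb s s′ s″ bb′ bb″ rw wb′)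
                          (λ (rw , wb″) → rw , transfer rb s s″ s′ bb″ bb′ rw wb″))
               (adj? H r w ×-dec adj? H w b′) (adj? H r w ×-dec adj? H w b″))
      (∈-allFin w) (dec-true (adj? H r w ×-dec adj? H w b′) (rw , wb′))

    Upper : Fin n → Set
    Upper v = ∃ λ b → Second b × Adj H v b × anchor b <ᶠ anchor v

    upper? : ∀ v → Dec (Upper v)
    upper? v = any? λ b → second? b ×-dec adj? H v b ×-dec (anchor b <ᶠ? anchor v)

    level : Fin n → Fin 3
    level v with second? v | upper? v
    ... | no _  | _     = zero
    ... | yes _ | yes _ = suc zero
    ... | yes _ | no _  = suc (suc zero)

    -- By `anchor-unique` all second-class neighbours of `u` share the anchor of `v`, so `Upper u`
    -- amounts to `anchor v <ᶠ anchor u`, and symmetrically. Equal anchors would form a triangle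
    -- with `u` and `v`.
    upper-separates : ∀ {u v} → Reach 3 r u → Reach 3 r v → Adj H u v → Second u → Second v →
      (Upper u → ¬ Upper v) × ¬ (¬ Upper u × ¬ Upper v)
    upper-separates {u} {v} ru rv uv su sv =
      (λ { (b , sb , ub , b<u) (b′ , sb′ , vb′ , b′<v) → <ᶠ-asym
        (subst (_<ᶠ anchor u) (anchor-unique ru su sb sv ub uv) b<u)
        (subst (_<ᶠ anchor v) (anchor-unique rv sv sb′ su vb′ (sw uv)) b′<v) })
      , λ { (¬u , ¬v) → neither ¬u ¬v }
      where
      neither : ¬ Upper u → ¬ Upper v → ⊥
      neither ¬u ¬v with <ᶠ-cmp (anchor u) (anchor v)
      ... | tri< u<v _ _ = ¬v (u , su , sw uv , u<v)
      ... | tri> _ _ v<u = ¬u (v , sv , uv , v<u)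
      ... | tri≈ _ eq _  = triangle-free ru uv (sw (proj₂ (anchor-adj su)))
        (subst (Adj H v) (sym eq) (sw (proj₂ (anchor-adj sv))))

    -- If neither end is adjacent to `r`, then `u` is at distance three, and a shortest path from
    -- `r` to `u` prolonged by `v` is an induced P5.
    outer-independent : ∀ {u v} → Reach 3 r u → Adj H u v → ¬ Second u → ¬ Second v → ⊥
    outer-independent {u} {v} ru uv ¬su ¬sv with adj? H r u | adj? H r v
    ... | yes a  | yes b  = triangle-free {r} (reach-refl {3}) a b uv
    ... | yes a  | no ¬b  = ¬sv (¬b , u , a , uv)
    ... | no ¬a  | yes b  = ¬su (¬a , v , b , sw uv)
    ... | no ¬a  | no ¬b  = third ru
      where
      third : Reach 3 r u → ⊥
      third (inj₁ (inj₁ (inj₁ refl))) = ¬b uv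
      third (inj₁ (inj₁ (inj₂ (_ , refl , ru)))) = ¬a ru
      third (inj₁ (inj₂ (_ , inj₁ refl , ru))) = ¬a ru
      third (inj₁ (inj₂ (w , inj₂ (_ , refl , rw) , wu))) = ¬su (¬a , w , rw , wu)
      third (inj₂ (_ , inj₁ (inj₁ refl) , ru)) = ¬a ru
      third (inj₂ (w , inj₁ (inj₂ (_ , refl , rw)) , wu)) = ¬su (¬a , w , rw , wu)
      third (inj₂ (w , inj₂ (_ , inj₁ refl , rw) , wu)) = ¬su (¬a , w , rw , wu)
      third (inj₂ (b , inj₂ (w , inj₂ (_ , refl , rw) , wb) , bu)) with adj? H r b
      ... | yes rb = ¬su (¬a , b , rb , bu)
      ... | no ¬rb = path-free rw wb bu uv ¬rb ¬a ¬b
        (λ wu → ¬su (¬a , w , rw , wu)) (λ wv → ¬sv (¬b , w , rw , wv))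
        (λ bv → triangle-free ru (sw bu) uv bv)

    three-colorable : ComponentColorable 3 r
    three-colorable = level , proper
      where
      proper : ∀ {u v} → Reach 3 r u → Reach 3 r v → Adj H u v → level u ≢ level v
      proper {u} {v} ru rv uv eq with second? u | upper? u | second? v | upper? v
      ... | no ¬su | _      | no ¬sv | _      = outer-independent ru uv ¬su ¬sv
      ... | yes su | yes pu | yes sv | yes pv = proj₁ (upper-separates ru rv uv su sv) pu pv
      ... | yes su | no ¬pu | yes sv | no ¬pv = proj₂ (upper-separates ru rv uv su sv) (¬pu , ¬pv)
      proper ru rv uv () | no _  | _     | yes _ | yes _
      proper ru rv uv () | no _  | _     | yes _ | no _
      proper ru rv uv () | yes _ | yes _ | no _  | _
      proper ru rv uv () | yes _ | no _  | no _  | _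
      proper ru rv uv () | yes _ | yes _ | yes _ | no _
      proper ru rv uv () | yes _ | no _  | yes _ | yes _

  module Multipartite (paw-free : PawFree H) where

    Triangle : Fin n → Fin n → Fin n → Set
    Triangle x y z = Adj H x y × Adj H x z × Adj H y z

    InTriangle : Fin n → Set
    InTriangle x = ∃ λ y → ∃ λ z → Triangle x y z

    inTriangle? : ∀ x → Dec (InTriangle x)
    inTriangle? x = any? λ y → any? λ z → adj? H x y ×-dec adj? H x z ×-dec adj? H y z

    edge-in-triangle : ∀ {a b} → InTriangle a → Adj H a b → ∃ λ d → Adj H a d × Adj H b d
    edge-in-triangle (x , y , ax , ay , xy) ab with paw-free ax ay xy ab
    ... | inj₁ xb = x , ax , sw xb
    ... | inj₂ yb = y , ay , sw yb

    inTriangle-step : ∀ {a b} → Adj H a b → InTriangle a → InTriangle b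
    inTriangle-step {a} {b} ab t with edge-in-triangle t ab
    ... | d , ad , bd = a , d , sw ab , bd , ad

    Touches : Fin n → Fin n → Fin n → Fin n → Set
    Touches x y z v = Adj H x v ⊎ Adj H y v ⊎ Adj H z v

    -- By paw-freeness, a vertex `u` adjacent to one corner is adjacent to two. These form a
    -- triangle with `u`, so the neighbour `v` of `u` is adjacent to one of them.
    touches-step : ∀ {x y z u v} → Triangle x y z → Adj H u v → Touches x y z u → Touches x y z v
    touches-step {x} {y} {z} {u} {v} (xy , xz , yz) uv = from
      where
      via : ∀ {p q} → Adj H p u → Adj H q u → Adj H p q → Adj H p v ⊎ Adj H q v
      via pu qu pq = paw-free (sw pu) (sw qu) pq uv
      from : Touches x y z u → Touches x y z v
      from (inj₁ xu) with paw-free xy xz yz xu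
      ... | inj₁ yu = [ inj₁ , inj₂ ∘ inj₁ ] (via xu yu xy)
      ... | inj₂ zu = [ inj₁ , inj₂ ∘ inj₂ ] (via xu zu xz)
      from (inj₂ (inj₁ yu)) with paw-free (sw xy) yz xz yu
      ... | inj₁ xu = [ inj₁ , inj₂ ∘ inj₁ ] (via xu yu xy)
      ... | inj₂ zu = inj₂ (via yu zu yz)
      from (inj₂ (inj₂ zu)) with paw-free (sw xz) (sw yz) xy zu
      ... | inj₁ xu = [ inj₁ , inj₂ ∘ inj₂ ] (via xu zu xz)
      ... | inj₂ yu = inj₂ (via yu zu yz)

    module _ (r : Fin n) (r∈triangle : InTriangle r) where

      -- Equivalently, non-adjacency is transitive on the component of r.
      edge-dominates : ∀ {a b c} → Reach 3 r a → Reach 3 r c → Adj H a b → Adj H a c ⊎ Adj H b c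
      edge-dominates {a} {b} ra rc ab with edge-in-triangle (along inTriangle-step 3 ra r∈triangle) ab
      -- `a` touches the triangle `a b d` through `b`; `spread` carries this back to `r` and on to
      -- `c`.
      ... | d , ad , bd with along spread 3 rc (back spread 3 ra (inj₂ (inj₁ (sw ab))))
        where
        spread : ∀ {u v} → Adj H u v → Touches a b d u → Touches a b d v
        spread = touches-step (ab , ad , bd)
      ... | inj₁ ac        = inj₁ ac
      ... | inj₂ (inj₁ bc) = inj₂ bc
      ... | inj₂ (inj₂ dc) = paw-free (sw ad) (sw bd) ab dc

      -- A greedy maximal clique, which picks one vertex from each part of the component.
      representatives : (vs : List (Fin n)) → Σ (List (Fin n)) λ ks → IsClique H ks × All (Reach 3 r) ks ×
        (∀ {v} → v ∈ vs → Reach 3 r v → Any (λ k → ¬ Adj H k v) ks)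
      representatives [] = [] , ([] , λ ()) , [] , λ ()
      representatives (v ∷ vs) with representatives vs | reach? 3 r v
      ... | ks , clique , reached , cover | no ¬rv = ks , clique , reached ,
        λ { (here refl) rv → ⊥-elim (¬rv rv) ; (there v∈) → cover v∈ }
      ... | ks , clique , reached , cover | yes rv with Any.any? (λ k → ¬? (adj? H k v)) ks
      ... | yes missed = ks , clique , reached , λ { (here refl) _ → missed ; (there v∈) → cover v∈ }
      ... | no complete = v ∷ ks
        , (All.map (λ kv e → ¬loop (subst (Adj H _) e kv)) kvs ∷ proj₁ clique , adjacent)
        , rv ∷ reached , λ { (here refl) _ → here ¬loop ; (there v∈) r′ → there (cover v∈ r′) }
        where
        kvs : All (λ k → Adj H k v) ks
        kvs = All.map (decidable-stable (adj? H _ v)) (¬Any⇒All¬ ks complete)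
        adjacent : ∀ {a b} → a ∈ v ∷ ks → b ∈ v ∷ ks → a ≢ b → Adj H a b
        adjacent (here refl) (here refl) a≢b = ⊥-elim (a≢b refl)
        adjacent (here refl) (there b∈)  _   = sw (All.lookup kvs b∈)
        adjacent (there a∈)  (here refl) _   = All.lookup kvs a∈
        adjacent (there a∈)  (there b∈)  a≢b = proj₂ clique a∈ b∈ a≢b

      -- The colour is the position of a clique member that the vertex misses. Two adjacent vertices
      -- missing the same member would contradict `edge-dominates`.
      multipartite-colorable : ∀ {m} → (∀ vs → IsClique H vs → length vs ≤ suc m) →
        ComponentColorable (suc m) r
      multipartite-colorable {m} bound with representatives (List.allFin n)
      ... | ks , clique , reached , cover = part , proper
        where
        part : Fin n → Fin (suc m)
        part v with reach? 3 r v
        ... | yes rv = inject≤ (Any.index (cover (∈-allFin v) rv)) (bound ks clique)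
        ... | no _   = zero
        part-missed : ∀ {v} → Reach 3 r v → Σ (Fin (length ks)) λ i →
          part v ≡ inject≤ i (bound ks clique) × ¬ Adj H (List.lookup ks i) v
        part-missed {v} rv with reach? 3 r v
        ... | yes rv′ = _ , refl , lookup-index (cover (∈-allFin v) rv′)
        ... | no ¬rv  = ⊥-elim (¬rv rv)
        proper : ∀ {u v} → Reach 3 r u → Reach 3 r v → Adj H u v → part u ≢ part v
        proper {u} {v} ru rv uv eq with part-missed ru | part-missed rv
        ... | i , eᵢ , ¬iu | j , eⱼ , ¬jv with inject≤-injective _ _ i j (trans (sym eᵢ) (trans eq eⱼ))
        ... | refl = [ ¬iu ∘ sw , ¬jv ∘ sw ] (edge-dominates ru (All.lookup reached (∈-lookup i)) uv)

paw-free-colorable : ∀ {n m} (H : Graph n) → PathFree H → PawFree H →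
  (∀ vs → IsClique H vs → length vs ≤ 3 + m) → Colorable H (3 + m)
paw-free-colorable {n} {m} H path-free paw-free bound = componentwise color
  where
  open Components H path-free
  open Multipartite paw-free
  color : ∀ r → ComponentColorable (3 + m) r
  color r with inTriangle? r
  ... | yes t = multipartite-colorable r t bound
  -- A triangle anywhere in the component would give one at `r`, by `inTriangle-step`.
  ... | no ¬t with Levels.three-colorable r (λ ra ab ac bc → ¬t (back inTriangle-step 3 ra (_ , _ , ab , ac , bc)))
  ... | c , proper = (λ v → c v ↑ˡ m) , λ ru rv uv eq → proper ru rv uv (↑ˡ-injective m _ _ eq)

-- Rows over a partial wheel

vecs : ∀ k → List (Vec Bool k)
vecs zero    = [] ∷ []
vecs (suc k) = cartesianProductWith _∷_ (I ∷ O ∷ []) (vecs k)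

∈-vecs : ∀ {k} (r : Vec Bool k) → r ∈ vecs k
∈-vecs []      = here refl
∈-vecs (I ∷ r) = ∈-cartesianProductWith⁺ _∷_ {xs = I ∷ O ∷ []} (here refl) (∈-vecs r)
∈-vecs (O ∷ r) = ∈-cartesianProductWith⁺ _∷_ {xs = I ∷ O ∷ []} (there (here refl)) (∈-vecs r)

-- A superset of the rows that occur in the graph: the test sees only `B` and one further vertex.
rows : ∀ {k} → Mat k → List (Vec Bool k)
rows B = filter (λ r → admissible (B ▹ r) ≟ᵇ true) (vecs _)

-- A row lists the adjacencies of a vertex to d extra vertices followed by the
-- five vertices of a 5-cycle.
Far : ∀ d → Vec Bool (d + 5) → Set
Far d r = drop d r ≡ replicate 5 O

far? : ∀ d r → Dec (Far d r)
far? d r = ≡-dec _≟ᵇ_ (drop d r) (replicate 5 O)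

fars nears : ∀ d → List (Vec Bool (d + 5)) → List (Vec Bool (d + 5))
fars  d = filter (far? d)
nears d = filter (¬? ∘ far? d)

-- Colourings determined by rows, and the finite checks on them

Colour : Set
Colour = Fin 6

pattern c0 = zero
pattern c1 = suc c0
pattern c2 = suc c1
pattern c3 = suc c2
pattern c4 = suc c3
pattern c5 = suc c4

-- The near neighbours of a distant component with an edge never use two
-- clashing colours, nor c5.
Clash : Colour → Colour → Set
Clash a b = (a ≡ c1 × b ≡ c2) ⊎ (a ≡ c3 × b ≡ c4)

clash? : ∀ a b → Dec (Clash a b)
clash? a b = ((a ≟ᶠ c1) ×-dec (b ≟ᶠ c2)) ⊎-dec ((a ≟ᶠ c3) ×-dec (b ≟ᶠ c4))

module _ (d : ℕ) (B : Mat (d + 5)) where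

  -- The leading bits of a row refer to the vertices added before it, latest first: in `I ∷ O ∷ u`
  -- the new vertex is adjacent to the distant `t` but not to the near `r`.
  Homogeneous : List (Vec Bool (d + 5)) → Set
  Homogeneous L = All (λ r → All (λ t → All (λ u →
    Blocked (B ▹ r ▹ (I ∷ t) ▹ (I ∷ O ∷ u))) (fars d L)) (fars d L)) (nears d L)

  homogeneous? : ∀ L → Dec (Homogeneous L)
  homogeneous? L = All.all? (λ r → All.all? (λ t → All.all? (λ u →
    blocked?) (fars d L)) (fars d L)) (nears d L)

  module _ (colour : Vec Bool (d + 5) → Colour) (N F : List (Vec Bool (d + 5))) where

    Proper : Set
    Proper = All (λ r → All (λ s → colour r ≡ colour s → Blocked (B ▹ r ▹ (I ∷ s))) N) N

    proper? : Dec Proper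
    proper? = All.all? (λ r → All.all? (λ s → (colour r ≟ᶠ colour s) →-dec blocked?) N) N

    Avoids5 : Set
    Avoids5 = All (λ r → colour r ≡ c5 → All (λ t → Blocked (B ▹ r ▹ (I ∷ t))) F) N

    avoids5? : Dec Avoids5
    avoids5? = All.all? (λ r → (colour r ≟ᶠ c5) →-dec All.all? (λ t → blocked?) F) N

    -- For a non-adjacent pair one common distant neighbour must already be blocked; for an adjacent
    -- pair, a distant edge completing it to a K4.
    ClashFree : Set
    ClashFree = All (λ r → All (λ s → Clash (colour r) (colour s) → All (λ t →
      Blocked (B ▹ r ▹ (O ∷ s) ▹ (I ∷ I ∷ t)) ×
      All (λ u → Blocked (B ▹ r ▹ (I ∷ s) ▹ (I ∷ I ∷ t) ▹ (I ∷ I ∷ I ∷ u))) F) F) N) N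

    clashFree? : Dec ClashFree
    clashFree? = All.all? (λ r → All.all? (λ s → clash? (colour r) (colour s) →-dec All.all? (λ t →
      blocked? ×-dec All.all? (λ u → blocked?) F) F) N) N

    Valid : Set
    Valid = Proper × Avoids5 × ClashFree

    valid? : Dec Valid
    valid? = proper? ×-dec avoids5? ×-dec clashFree?

ValidOn : ∀ d → Mat (d + 5) → (Vec Bool (d + 5) → Colour) → List (Vec Bool (d + 5)) → Set
ValidOn d B colour L = Valid d B colour (nears d L) (fars d L)

validOn? : ∀ d B colour L → Dec (ValidOn d B colour L)
validOn? d B colour L = valid? d B colour (nears d L) (fars d L)

-- Found by computer search.  The entries of a row are the adjacencies to
-- v0, …, v5, preceded in colourZ by that to z.  The last clauses also cover the
-- rows that no vertex realises.
colourY : Vec Bool 6 → Colour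
colourY (O ∷ O ∷ I ∷ O ∷ I ∷ I ∷ []) = c1
colourY (O ∷ I ∷ O ∷ I ∷ I ∷ O ∷ []) = c3
colourY (I ∷ O ∷ I ∷ O ∷ I ∷ I ∷ []) = c4
colourY (I ∷ O ∷ I ∷ I ∷ O ∷ I ∷ []) = c4
colourY (I ∷ I ∷ O ∷ I ∷ O ∷ I ∷ []) = c2
colourY (I ∷ I ∷ O ∷ I ∷ I ∷ O ∷ []) = c2
colourY (O ∷ O ∷ I ∷ O ∷ O ∷ I ∷ []) = c1
colourY (O ∷ O ∷ I ∷ O ∷ I ∷ O ∷ []) = c1
colourY (O ∷ I ∷ O ∷ O ∷ I ∷ O ∷ []) = c3
colourY (O ∷ I ∷ O ∷ I ∷ O ∷ O ∷ []) = c3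
colourY (I ∷ O ∷ O ∷ I ∷ O ∷ I ∷ []) = c5
colourY (I ∷ O ∷ I ∷ O ∷ O ∷ I ∷ []) = c4
colourY (I ∷ O ∷ I ∷ O ∷ I ∷ O ∷ []) = c4
colourY (I ∷ I ∷ O ∷ O ∷ I ∷ O ∷ []) = c2
colourY (I ∷ I ∷ O ∷ I ∷ O ∷ O ∷ []) = c2
colourY _ = c0

colourZ : Vec Bool 7 → Colour
colourZ (O ∷ I ∷ O ∷ I ∷ O ∷ I ∷ I ∷ []) = c1
colourZ (O ∷ I ∷ I ∷ O ∷ I ∷ O ∷ I ∷ []) = c2
colourZ (O ∷ I ∷ I ∷ O ∷ I ∷ I ∷ O ∷ []) = c2
colourZ (I ∷ O ∷ I ∷ I ∷ O ∷ I ∷ O ∷ []) = c3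
colourZ (I ∷ I ∷ O ∷ I ∷ I ∷ O ∷ I ∷ []) = c4
colourZ (O ∷ O ∷ I ∷ O ∷ O ∷ I ∷ O ∷ []) = c5
colourZ (O ∷ O ∷ I ∷ O ∷ I ∷ O ∷ O ∷ []) = c5
colourZ (O ∷ I ∷ O ∷ O ∷ I ∷ O ∷ I ∷ []) = c1
colourZ (O ∷ I ∷ I ∷ O ∷ O ∷ I ∷ O ∷ []) = c2
colourZ (O ∷ I ∷ I ∷ O ∷ I ∷ O ∷ O ∷ []) = c2
colourZ (I ∷ O ∷ O ∷ I ∷ O ∷ O ∷ I ∷ []) = c4
colourZ (I ∷ O ∷ O ∷ I ∷ O ∷ I ∷ O ∷ []) = c3
colourZ (I ∷ O ∷ I ∷ O ∷ O ∷ I ∷ O ∷ []) = c3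
colourZ (I ∷ O ∷ I ∷ O ∷ I ∷ O ∷ O ∷ []) = c5
colourZ (I ∷ I ∷ O ∷ O ∷ I ∷ O ∷ I ∷ []) = c4
colourZ (I ∷ I ∷ O ∷ I ∷ O ∷ O ∷ I ∷ []) = c4
colourZ _ = c0

-- The rows of the vertices z adjacent to all of the wheel but v1, respectively v2.
Z₁ Z₂ : Vec Bool 6
Z₁ = I ∷ O ∷ I ∷ I ∷ I ∷ I ∷ []
Z₂ = I ∷ I ∷ O ∷ I ∷ I ∷ I ∷ []

notZ? : (r : Vec Bool 6) → Dec (r ≢ Z₁ × r ≢ Z₂)
notZ? r = ¬? (≡-dec _≟ᵇ_ r Z₁) ×-dec ¬? (≡-dec _≟ᵇ_ r Z₂)

withoutZ : List (Vec Bool 6)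
withoutZ = filter notZ? (rows Y5ᵐ)

homogeneous : Homogeneous 1 Y5ᵐ (rows Y5ᵐ)
homogeneous = toWitness {a? = homogeneous? 1 Y5ᵐ (rows Y5ᵐ)} _

validY : ValidOn 1 Y5ᵐ colourY withoutZ
validY = toWitness {a? = validOn? 1 Y5ᵐ colourY withoutZ} _

validZ : ValidOn 2 (Y5ᵐ ▹ Z₂) colourZ (rows (Y5ᵐ ▹ Z₂))
validZ = toWitness {a? = validOn? 2 (Y5ᵐ ▹ Z₂) colourZ (rows (Y5ᵐ ▹ Z₂))} _

-- Extending a colouring of the distant vertices

Distant : ∀ {n} → Graph n → Vec (Fin n) 5 → Fin n → Set
Distant G cycle v = map (adj G v) cycle ≡ replicate 5 O

distant? : ∀ {n} (G : Graph n) cycle v → Dec (Distant G cycle v)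
distant? G cycle v = ≡-dec _≟ᵇ_ (map (adj G v) cycle) (replicate 5 O)

Transfers : ∀ {n} → Graph n → Vec (Fin n) 5 → Set
Transfers G cycle = ∀ {y t u} → ¬ Distant G cycle y → Distant G cycle t → Distant G cycle u →
  Adj G t u → Adj G y t → Adj G y u

drop-map-++ : ∀ {A B : Set} {d k} (f : A → B) (xs : Vec A d) (ys : Vec A k) →
  drop d (map f (xs ++ ys)) ≡ map f ys
drop-map-++ f []       ys = refl
drop-map-++ f (x ∷ xs) ys = drop-map-++ f xs ys

-- `extra` will be the centre alone, or `z` followed by the centre.
module Rows {n : ℕ} {G : Graph n} (adm : Admissible G)
  {d : ℕ} (extra : Vec (Fin n) d) (cycle : Vec (Fin n) 5)
  {B : Mat (d + 5)} (base : matOf (adj G) (extra ++ cycle) ≡ B) where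

  row : Fin n → Vec Bool (d + 5)
  row v = map (adj G v) (extra ++ cycle)

  row∈rows : ∀ v → row v ∈ rows B
  row∈rows v = ∈-filter⁺ (λ r → admissible (B ▹ r) ≟ᵇ true) (∈-vecs (row v))
    (subst (λ M → admissible (M ▹ row v) ≡ true) base (Admissible.admissible-tuple adm (v ∷ extra ++ cycle)))

  row∈fars : ∀ {L v} → row v ∈ L → Distant G cycle v → row v ∈ fars d L
  row∈fars r∈ dist = ∈-filter⁺ (far? d) r∈ (trans (drop-map-++ _ extra cycle) dist)

  row∈nears : ∀ {L v} → row v ∈ L → ¬ Distant G cycle v → row v ∈ nears d L
  row∈nears r∈ near = ∈-filter⁺ (¬? ∘ far? d) r∈ (near ∘ trans (sym (drop-map-++ _ extra cycle)))

  homogeneous⇒transfers : Homogeneous d B (rows B) → Transfers G cycle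
  homogeneous⇒transfers hom {y} {t} {u} near dt du tu yt with adj G y u in yu
  ... | I = refl
  ... | O = ⊥-elim (admissible⇒¬blocked adm (u ∷ t ∷ y ∷ extra ++ cycle) bl)
    where
    bl : Blocked (matOf (adj G) (u ∷ t ∷ y ∷ extra ++ cycle))
    -- The rewrites turn the matrix of the tuple into a pattern listed in `Homogeneous`.
    bl rewrite base | trans (adj-sym G u t) tu | trans (adj-sym G u y) yu | trans (adj-sym G t y) yt =
      All.lookup (All.lookup (All.lookup hom (row∈nears (row∈rows y) near)) (row∈fars (row∈rows t) dt))
        (row∈fars (row∈rows u) du)

  module _ (L : List (Vec Bool (d + 5))) (row∈L : ∀ v → row v ∈ L) (colour : Vec Bool (d + 5) → Colour)
    (valid : ValidOn d B colour L) (transfers : Transfers G cycle) where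

    private
      near∈ : ∀ {v} → ¬ Distant G cycle v → row v ∈ nears d L
      near∈ = row∈nears (row∈L _)

      far∈ : ∀ {v} → Distant G cycle v → row v ∈ fars d L
      far∈ = row∈fars (row∈L _)

    near-proper : ∀ {y z} → ¬ Distant G cycle y → ¬ Distant G cycle z → Adj G y z →
      colour (row y) ≢ colour (row z)
    near-proper {y} {z} ny nz yz eq = admissible⇒¬blocked adm (z ∷ y ∷ extra ++ cycle) bl
      where
      bl : Blocked (matOf (adj G) (z ∷ y ∷ extra ++ cycle))
      bl rewrite base | trans (adj-sym G z y) yz = All.lookup (All.lookup (proj₁ valid) (near∈ ny)) (near∈ nz) eq

    avoids5 : ∀ {y t} → ¬ Distant G cycle y → Distant G cycle t → Adj G y t → colour (row y) ≢ c5
    avoids5 {y} {t} ny dt yt eq = admissible⇒¬blocked adm (t ∷ y ∷ extra ++ cycle) bl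
      where
      bl : Blocked (matOf (adj G) (t ∷ y ∷ extra ++ cycle))
      bl rewrite base | trans (adj-sym G t y) yt =
        All.lookup (All.lookup (proj₁ (proj₂ valid)) (near∈ ny) eq) (far∈ dt)

    clash-free : ∀ {y z t u} → ¬ Distant G cycle y → ¬ Distant G cycle z →
      Distant G cycle t → Distant G cycle u →
      Adj G t u → Adj G y t → Adj G z t → ¬ Clash (colour (row y)) (colour (row z))
    clash-free {y} {z} {t} {u} ny nz dt du tu yt zt cl with adj G z y in zy
    ... | O = admissible⇒¬blocked adm (t ∷ z ∷ y ∷ extra ++ cycle) bl
      where
      bl : Blocked (matOf (adj G) (t ∷ z ∷ y ∷ extra ++ cycle))
      bl rewrite base | zy | trans (adj-sym G t y) yt | trans (adj-sym G t z) zt =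
        proj₁ (All.lookup (All.lookup (All.lookup (proj₂ (proj₂ valid)) (near∈ ny)) (near∈ nz) cl) (far∈ dt))
    -- By `transfers`, `u` is adjacent to `y` and `z` too, so `y`, `z`, `t`, `u` form a K4.
    ... | I = admissible⇒¬blocked adm (u ∷ t ∷ z ∷ y ∷ extra ++ cycle) bl
      where
      bl : Blocked (matOf (adj G) (u ∷ t ∷ z ∷ y ∷ extra ++ cycle))
      bl rewrite base | zy | trans (adj-sym G t y) yt | trans (adj-sym G t z) zt
        | trans (adj-sym G u t) tu | trans (adj-sym G u y) (transfers ny dt du tu yt)
        | trans (adj-sym G u z) (transfers nz dt du tu zt) =
        All.lookup (proj₂ (All.lookup (All.lookup (All.lookup (proj₂ (proj₂ valid)) (near∈ ny)) (near∈ nz) cl)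
          (far∈ dt))) (far∈ du)

-- The two flags tell whether the colours c1 and c3 are seen.
palette : Bool → Bool → Fin 3 → Colour
palette p q zero             = c5
palette p q (suc zero)       = if p then c2 else c1
palette p q (suc (suc zero)) = if q then c4 else c3

palette-injective : ∀ p q {i j} → palette p q i ≡ palette p q j → i ≡ j
palette-injective p q {i} {j} = from-yes (allᵇ? λ p → allᵇ? λ q → all? λ i → all? λ j →
    (palette p q i ≟ᶠ palette p q j) →-dec (i ≟ᶠ j)) p q i j
  where
  allᵇ? : {P : Bool → Set} → (∀ b → Dec (P b)) → Dec (∀ b → P b)
  allᵇ? P? = map′ (λ { (x , y) false → x ; (x , y) true → y }) (λ f → f false , f true)
    (P? false ×-dec P? true)

module _ {n : ℕ} (G : Graph n) (cycle : Vec (Fin n) 5) (transfers : Transfers G cycle) (colour : Fin n → Colour)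
  (near-proper : ∀ {y z} → ¬ Distant G cycle y → ¬ Distant G cycle z → Adj G y z → colour y ≢ colour z)
  (avoids5 : ∀ {y t} → ¬ Distant G cycle y → Distant G cycle t → Adj G y t → colour y ≢ c5)
  (clash-free : ∀ {y z t u} → ¬ Distant G cycle y → ¬ Distant G cycle z →
    Distant G cycle t → Distant G cycle u →
    Adj G t u → Adj G y t → Adj G z t → ¬ Clash (colour y) (colour z))
  {m : ℕ} (κ : Fin n → Fin (3 + m))
  (κ-proper : ∀ {t u} → Distant G cycle t → Distant G cycle u → Adj G t u → κ t ≢ κ u) where

  private
    Sees : Colour → Fin n → Set
    Sees i t = ∃ λ y → ¬ Distant G cycle y × Adj G y t × colour y ≡ i

    sees? : ∀ i t → Dec (Sees i t)
    sees? i t = any? λ y → ¬? (distant? G cycle y) ×-dec (adj G y t ≟ᵇ true) ×-dec (colour y ≟ᶠ i)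

    -- The case in which `clash-free` applies, and hence the palette is unseen.
    Accompanied : Fin n → Set
    Accompanied t = ∃ λ u → Distant G cycle u × Adj G t u

    accompanied? : ∀ t → Dec (Accompanied t)
    accompanied? t = any? λ u → distant? G cycle u ×-dec (adj G t u ≟ᵇ true)

    -- By `transfers` in both directions, adjacent distant vertices have the same near neighbours.
    -- They therefore use the same palette, and the renaming keeps `κ` proper.
    sees-cong : ∀ {t u} i → Distant G cycle t → Distant G cycle u → Adj G t u →
      does (sees? i t) ≡ does (sees? i u)
    sees-cong {t} {u} i dt du tu = does-⇔ (mk⇔
      (λ (y , ny , yt , e) → y , ny , transfers ny dt du tu yt , e)
      (λ (y , ny , yu , e) → y , ny , transfers ny du dt (trans (adj-sym G u t) tu) yu , e))
      (sees? i t) (sees? i u)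

    paletteAt : Fin n → Fin 3 → Colour
    paletteAt t = palette (does (sees? c1 t)) (does (sees? c3 t))

    -- If `c1` is seen, the palette offers `c2`, which clashes with it and so cannot be seen as
    -- well; likewise for `c3` and `c4`.
    palette-unseen : ∀ {y t} i → ¬ Distant G cycle y → Distant G cycle t → Adj G y t → Accompanied t →
      paletteAt t i ≢ colour y
    palette-unseen zero ny dt yt _ eq = avoids5 ny dt yt (sym eq)
    palette-unseen {y} {t} (suc zero) ny dt yt (u , du , tu) eq with sees? c1 t
    ... | yes (z , nz , zt , z1) = clash-free nz ny dt du tu zt yt (inj₁ (z1 , sym eq))
    ... | no unseen = unseen (y , ny , yt , sym eq)
    palette-unseen {y} {t} (suc (suc zero)) ny dt yt (u , du , tu) eq with sees? c3 t
    ... | yes (z , nz , zt , z3) = clash-free nz ny dt du tu zt yt (inj₂ (z3 , sym eq))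
    ... | no unseen = unseen (y , ny , yt , sym eq)

    map₁-injective : ∀ {A B C : Set} {f : A → C} → (∀ {i j} → f i ≡ f j → i ≡ j) →
      ∀ {x y : A ⊎ B} → map₁ f x ≡ map₁ f y → x ≡ y
    map₁-injective inj {inj₁ a} {inj₁ b} e = cong inj₁ (inj (inj₁-injective e))
    map₁-injective inj {inj₂ a} {inj₂ b} e = cong inj₂ (inj₂-injective e)

    splitAt-injective : ∀ {i j : Fin (3 + m)} → splitAt 3 i ≡ splitAt 3 j → i ≡ j
    splitAt-injective {i} {j} e =
      trans (sym (join-splitAt 3 m i)) (trans (cong (join 3 m) e) (join-splitAt 3 m j))

    -- The first three colours of `κ` are renamed through the palette, and the other `m` serve as
    -- new colours. An isolated distant vertex takes `c5`, which none of its neighbours has.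
    full : Fin n → Colour ⊎ Fin m
    full v with distant? G cycle v | accompanied? v
    ... | no _  | _     = inj₁ (colour v)
    ... | yes _ | no _  = inj₁ c5
    ... | yes _ | yes _ = map₁ (paletteAt v) (splitAt 3 (κ v))

    full-near : ∀ {y} → ¬ Distant G cycle y → full y ≡ inj₁ (colour y)
    full-near {y} ny with distant? G cycle y | accompanied? y
    ... | no _   | _ = refl
    ... | yes dy | _ = ⊥-elim (ny dy)

    full-far : ∀ {t} → Distant G cycle t → Accompanied t → full t ≡ map₁ (paletteAt t) (splitAt 3 (κ t))
    full-far {t} dt at with distant? G cycle t | accompanied? t
    ... | no nt | _      = ⊥-elim (nt dt)
    ... | yes _ | no ¬at = ⊥-elim (¬at at)
    ... | yes _ | yes _  = refl

    full-lonely : ∀ {t} → Distant G cycle t → ¬ Accompanied t → full t ≡ inj₁ c5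
    full-lonely {t} dt ¬at with distant? G cycle t | accompanied? t
    ... | no nt | _      = ⊥-elim (nt dt)
    ... | yes _ | no _   = refl
    ... | yes _ | yes at = ⊥-elim (¬at at)

    near≢far : ∀ {y t} → ¬ Distant G cycle y → Distant G cycle t → Adj G y t → full y ≢ full t
    near≢far {y} {t} ny dt yt eq = lonely-or-not (accompanied? t)
      where
      near≢ : ∀ {x} → full t ≡ x → inj₁ (colour y) ≡ x
      near≢ e = trans (sym (full-near ny)) (trans eq e)
      unseen : Accompanied t → ∀ x → inj₁ (colour y) ≢ map₁ (paletteAt t) x
      unseen at (inj₁ i) e = palette-unseen i ny dt yt at (sym (inj₁-injective e))
      unseen at (inj₂ j) ()
      lonely-or-not : ¬ Dec (Accompanied t)
      lonely-or-not (no ¬at) = avoids5 ny dt yt (inj₁-injective (near≢ (full-lonely dt ¬at)))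
      lonely-or-not (yes at) = unseen at (splitAt 3 (κ t)) (near≢ (full-far dt at))

    far≢far : ∀ {t u} → Distant G cycle t → Distant G cycle u → Adj G t u → full t ≢ full u
    far≢far {t} {u} dt du tu eq = κ-proper dt du tu (splitAt-injective
      (map₁-injective (palette-injective (does (sees? c1 u)) (does (sees? c3 u)))
        (trans (sym (subst₂ (λ p q → full t ≡ map₁ (palette p q) (splitAt 3 (κ t)))
                       (sees-cong c1 dt du tu) (sees-cong c3 dt du tu) (full-far dt (u , du , tu))))
          (trans eq (full-far du (t , dt , trans (adj-sym G u t) tu))))))

    full-proper : ∀ u v → Adj G u v → full u ≢ full v
    full-proper u v uv = cases (distant? G cycle u) (distant? G cycle v)
      where
      cases : Dec (Distant G cycle u) → Dec (Distant G cycle v) → full u ≢ full v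
      cases (no nu)  (no nv)  eq = near-proper nu nv uv
        (inj₁-injective (trans (sym (full-near nu)) (trans eq (full-near nv))))
      cases (no nu)  (yes dv) eq = near≢far nu dv uv eq
      cases (yes du) (no nv)  eq = near≢far nv du (trans (adj-sym G v u) uv) (sym eq)
      cases (yes du) (yes dv) eq = far≢far du dv uv eq

  colorable : Colorable G (6 + m)
  colorable = join 6 m ∘ full , λ u v uv eq → full-proper u v uv
    (trans (sym (splitAt-join 6 m (full u))) (trans (cong (splitAt 6) eq) (splitAt-join 6 m (full v))))

-- Consequences of the forbidden patterns, and induced subgraphs

admissible⇒pathFree : ∀ {n} {G : Graph n} → Admissible G → PathFree G
admissible⇒pathFree {G = G} adm {a} {b} {c} {d} {e} ab bc cd de ac ad ae bd be ce =
  admissible⇒¬blocked adm (a ∷ b ∷ c ∷ d ∷ e ∷ []) bl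
  where
  bl : Blocked (matOf (adj G) (a ∷ b ∷ c ∷ d ∷ e ∷ []))
  bl rewrite ab | bc | cd | de | ¬-not ac | ¬-not ad | ¬-not ae | ¬-not bd | ¬-not be | ¬-not ce = blocked refl

-- A paw with a vertex complete to it is an HVN: `y a b c` is the K4, and `d` sees just `y` and `a`.
admissible⇒¬paw+apex : ∀ {n} {G : Graph n} → Admissible G → ∀ {a b c d y} →
  Adj G a b → Adj G a c → Adj G b c → Adj G a d → ¬ Adj G b d → ¬ Adj G c d →
  Adj G y a → Adj G y b → Adj G y c → ¬ Adj G y d
admissible⇒¬paw+apex {G = G} adm {a} {b} {c} {d} {y} ab ac bc ad bd cd ya yb yc yd =
  admissible⇒¬blocked adm (y ∷ a ∷ b ∷ c ∷ d ∷ []) bl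
  where
  bl : Blocked (matOf (adj G) (y ∷ a ∷ b ∷ c ∷ d ∷ []))
  bl rewrite ab | ac | bc | ad | ¬-not bd | ¬-not cd | ya | yb | yc | yd = blocked refl

-- Vertices outside `P` stay as isolated ones, so that the vertex type is unchanged.
restrict : ∀ {n} (G : Graph n) {P : Fin n → Set} → (∀ v → Dec (P v)) → Graph n
restrict G P? = record
  { adj = λ u v → (does (P? u) ∧ does (P? v)) ∧ adj G u v
  ; adj-sym = λ u v → cong₂ _∧_ (∧-comm (does (P? u)) (does (P? v))) (adj-sym G u v)
  ; adj-irrefl = λ v → trans (cong ((does (P? v) ∧ does (P? v)) ∧_) (adj-irrefl G v)) (∧-zeroʳ _)
  }

restrict⁺ : ∀ {n} (G : Graph n) {P : Fin n → Set} (P? : ∀ v → Dec (P v)) {u v} →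
  P u → P v → Adj G u v → Adj (restrict G P?) u v
restrict⁺ G P? {u} {v} pu pv uv rewrite dec-true (P? u) pu | dec-true (P? v) pv = uv

restrict⁻ : ∀ {n} (G : Graph n) {P : Fin n → Set} (P? : ∀ v → Dec (P v)) {u v} →
  Adj (restrict G P?) u v → P u × P v × Adj G u v
restrict⁻ G P? {u} {v} uv with P? u | P? v
... | yes pu | yes pv = pu , pv , uv

restrict-pathFree : ∀ {n} (G : Graph n) {P : Fin n → Set} (P? : ∀ v → Dec (P v)) →
  PathFree G → PathFree (restrict G P?)
restrict-pathFree G P? free ab bc cd de ac ad ae bd be ce
  with restrict⁻ G P? ab | restrict⁻ G P? bc | restrict⁻ G P? cd | restrict⁻ G P? de
... | pa , pb , ab′ | _ , pc , bc′ | _ , pd , cd′ | _ , pe , de′ = free ab′ bc′ cd′ de′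
  (ac ∘ restrict⁺ G P? pa pc) (ad ∘ restrict⁺ G P? pa pd) (ae ∘ restrict⁺ G P? pa pe)
  (bd ∘ restrict⁺ G P? pb pd) (be ∘ restrict⁺ G P? pb pe) (ce ∘ restrict⁺ G P? pc pe)

restrict-clique : ∀ {n} (G : Graph n) {P : Fin n → Set} (P? : ∀ v → Dec (P v)) {vs} →
  IsClique (restrict G P?) vs → IsClique G vs
restrict-clique G P? (unique , adjacent) =
  unique , λ u∈ v∈ u≢v → proj₂ (proj₂ (restrict⁻ G P? (adjacent u∈ v∈ u≢v)))

-- Colouring the graph around a fixed wheel

module Wheel {n : ℕ} {G : Graph n} (adm : Admissible G) (connected : Connected G) {m : ℕ}
  (bound : ∀ vs → IsClique G vs → length vs ≤ 3 + m)
  (x : Fin n) (cycle : Vec (Fin n) 5) (base : matOf (adj G) (x ∷ cycle) ≡ Y5ᵐ) where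

  private
    sw : ∀ {u v} → Adj G u v → Adj G v u
    sw {u} {v} = trans (adj-sym G v u)

  transfers : Transfers G cycle
  transfers = Rows.homogeneous⇒transfers adm (x ∷ []) cycle base homogeneous

  cycle-near : ¬ Distant G cycle (lookup cycle zero)
  cycle-near dist with trans (sym (cong (λ r → lookup r (suc zero)) dist)) on-cycle
    where
    on-cycle : lookup (map (adj G (lookup cycle zero)) cycle) (suc zero) ≡ I
    on-cycle = trans (lookup-map (suc zero) _ cycle) (trans
      (sym (entry-matOf G (x ∷ cycle) (suc zero) (suc (suc zero))))
      (cong (λ M → entry M (suc zero) (suc (suc zero))) base))
  ... | ()

  -- On a walk to the rim, the last vertex before the first near one has a near neighbour;
  -- `transfers` carries this adjacency back to `t`.
  near-neighbour : ∀ {t} → Distant G cycle t → ∃ λ y → ¬ Distant G cycle y × Adj G y t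
  near-neighbour dt = along (connected _ _) cycle-near dt
    where
    along : ∀ {t v} → Walk G t v → ¬ Distant G cycle v → Distant G cycle t →
      ∃ λ y → ¬ Distant G cycle y × Adj G y t
    along (here _) nv dt = ⊥-elim (nv dt)
    along (step t w _ tw walk) nv dt with distant? G cycle w
    ... | no nw  = w , nw , sw tw
    ... | yes dw with along walk nv dw
    ... | y , ny , yw = y , ny , transfers ny dw dt (sw tw) yw

  distant : Graph n
  distant = restrict G (distant? G cycle)

  distant-pawFree : PawFree distant
  distant-pawFree {a} {b} {c} {d} ab ac bc ad = decidable-stable (adj? distant b d ⊎-dec adj? distant c d) refute
    where
    refute : ¬ ¬ (Adj distant b d ⊎ Adj distant c d)
    refute none with restrict⁻ G (distant? G cycle) ab | restrict⁻ G (distant? G cycle) ac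
      | restrict⁻ G (distant? G cycle) bc | restrict⁻ G (distant? G cycle) ad
    ... | da , db , ab′ | _ , dc , ac′ | _ , _ , bc′ | _ , dd , ad′ with near-neighbour da
    ... | y , ny , ya = admissible⇒¬paw+apex adm ab′ ac′ bc′ ad′
      (none ∘ inj₁ ∘ restrict⁺ G (distant? G cycle) db dd)
      (none ∘ inj₂ ∘ restrict⁺ G (distant? G cycle) dc dd)
      ya (transfers ny da db ab′ ya) (transfers ny da dc ac′ ya) (transfers ny da dd ad′ ya)

  distant-colorable : Colorable distant (3 + m)
  distant-colorable = paw-free-colorable distant
    (restrict-pathFree G (distant? G cycle) (admissible⇒pathFree adm)) distant-pawFree
    (λ vs clique → bound vs (restrict-clique G (distant? G cycle) clique))

  valid⇒colorable : ∀ {d B} (extra : Vec (Fin n) d) (base : matOf (adj G) (extra ++ cycle) ≡ B) →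
    ∀ L → (∀ v → map (adj G v) (extra ++ cycle) ∈ L) → ∀ colour →
    ValidOn d B colour L → Colorable G (6 + m)
  valid⇒colorable extra base L row∈L colour valid = colorable G cycle transfers (colour ∘ row)
    (near-proper L row∈L colour valid transfers)
    (avoids5 L row∈L colour valid transfers)
    (clash-free L row∈L colour valid transfers)
    (proj₁ distant-colorable)
    (λ dt du tu → proj₂ distant-colorable _ _ (restrict⁺ G (distant? G cycle) dt du tu))
    where open Rows adm extra cycle base

  colorable-with-Z₂ : ∀ z → map (adj G z) (x ∷ cycle) ≡ Z₂ → Colorable G (6 + m)
  colorable-with-Z₂ z z-row = valid⇒colorable (z ∷ x ∷ []) base′ (rows (Y5ᵐ ▹ Z₂))
    (Rows.row∈rows adm (z ∷ x ∷ []) cycle base′) colourZ validZ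
    where
    base′ : matOf (adj G) (z ∷ x ∷ cycle) ≡ (Y5ᵐ ▹ Z₂)
    base′ = cong₂ _▹_ base z-row

  colorable-without-Z : (∀ z → map (adj G z) (x ∷ cycle) ≢ Z₁) →
    (∀ z → map (adj G z) (x ∷ cycle) ≢ Z₂) →
    Colorable G (6 + m)
  colorable-without-Z ¬Z₁ ¬Z₂ = valid⇒colorable (x ∷ []) base withoutZ
    (λ v → ∈-filter⁺ notZ? (Rows.row∈rows adm (x ∷ []) cycle base v) (¬Z₁ v , ¬Z₂ v)) colourY validY

-- Orientation of the wheel and conclusion

triangle-clique : ∀ {n} {G : Graph n} {a b c} → Adj G a b → Adj G a c → Adj G b c →
  IsClique G (a ∷ b ∷ c ∷ [])
triangle-clique {G = G} {a} {b} {c} ab ac bc =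
  ((distinct ab ∷ distinct ac ∷ []) ∷ (distinct bc ∷ []) ∷ [] ∷ []) , adjacent
  where
  distinct : ∀ {u v} → Adj G u v → u ≢ v
  distinct {u} uu refl with trans (sym uu) (adj-irrefl G u)
  ... | ()
  sw : ∀ {u v} → Adj G u v → Adj G v u
  sw {u} {v} = trans (adj-sym G v u)
  adjacent : ∀ {u v} → u ∈ a ∷ b ∷ c ∷ [] → v ∈ a ∷ b ∷ c ∷ [] → u ≢ v → Adj G u v
  adjacent (here refl) (here refl) u≢v = ⊥-elim (u≢v refl)
  adjacent (here refl) (there (here refl)) _ = ab
  adjacent (here refl) (there (there (here refl))) _ = ac
  adjacent (there (here refl)) (here refl) _ = sw ab
  adjacent (there (here refl)) (there (here refl)) u≢v = ⊥-elim (u≢v refl)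
  adjacent (there (here refl)) (there (there (here refl))) _ = bc
  adjacent (there (there (here refl))) (here refl) _ = sw ac
  adjacent (there (there (here refl))) (there (here refl)) _ = sw bc
  adjacent (there (there (here refl))) (there (there (here refl))) u≢v = ⊥-elim (u≢v refl)

module _ {n : ℕ} {G : Graph n} (adm : Admissible G) (connected : Connected G) {m : ℕ}
  (bound : ∀ vs → IsClique G vs → length vs ≤ 3 + m) (wheel : InducedSub Y5Wheel G) where

  private
    f : Fin 6 → Fin n
    f = proj₁ wheel

    spokes mirrored : Vec (Fin 6) 6
    spokes   = v0 ∷ v1 ∷ v2 ∷ v3 ∷ v4 ∷ v5 ∷ []
    mirrored = v0 ∷ v2 ∷ v1 ∷ v5 ∷ v4 ∷ v3 ∷ []

    -- For `spokes` and for `mirrored` the right-hand side evaluates to `Y5ᵐ`, the reflection being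
    -- an automorphism of the wheel.
    wheel-base : (σ : Vec (Fin 6) 6) → matOf (adj G) (map f σ) ≡ matOf (adj Y5Wheel) σ
    wheel-base = matOf-map {E = adj G} {adj Y5Wheel} f λ i j → sym (proj₂ (proj₂ wheel) i j)

    -- The reflection of the wheel that swaps v1 and v2 also swaps Z₁ and Z₂.
    mirror-row : ∀ {z} → map (adj G z) (map f spokes) ≡ Z₁ → map (adj G z) (map f mirrored) ≡ Z₂
    mirror-row e = cong (λ { (a ∷ b ∷ c ∷ d ∷ e ∷ f ∷ []) → a ∷ c ∷ b ∷ f ∷ e ∷ d ∷ [] }) e

  wheel-colorable : Colorable G (6 + m)
  wheel-colorable with any? (λ z → ≡-dec _≟ᵇ_ (map (adj G z) (map f spokes)) Z₁)
    | any? (λ z → ≡-dec _≟ᵇ_ (map (adj G z) (map f spokes)) Z₂)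
  ... | yes (z , z-row) | _ =
    Wheel.colorable-with-Z₂ adm connected bound _ _ (wheel-base mirrored) z (mirror-row z-row)
  ... | no _ | yes (z , z-row) =
    Wheel.colorable-with-Z₂ adm connected bound _ _ (wheel-base spokes) z z-row
  ... | no ¬Z₁ | no ¬Z₂ = Wheel.colorable-without-Z adm connected bound _ _ (wheel-base spokes)
    (λ z e → ¬Z₁ (z , e)) (λ z e → ¬Z₂ (z , e))

theorem4p5 : (n : ℕ) (G : Graph n) (ω : ℕ) →
    Connected G → Free P5 G → Free HVN G →
    Contains G Y5Wheel → Free T5Wheel G →
    IsCliqueNumber G ω → Colorable G (ω + 3)
theorem4p5 n G ω connected p5 hvn wheel@(f , _ , pres) t5 (_ , bound)
  -- The triangle of the centre with `v1` and `v2` shows that `ω` has the form `3 + m`.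
  with bound (f v0 ∷ f v1 ∷ f v2 ∷ []) (triangle-clique {G = G} (pres v0 v1) (pres v0 v2) (pres v1 v2))
... | s≤s (s≤s (s≤s {n = m} _)) = subst (λ k → Colorable G (3 + k)) (+-comm 3 m)
  (wheel-colorable (free⇒admissible {G = G} p5 hvn t5) connected bound wheel)
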